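{- Let $\varphi\in\mathcal L_\Diamond$. If $\varphi$ is valid over the class of all dynamical systems, then $\varphi$ is derivable in the logic ${\sf ITL}^0_\Diamond$.
   Context: Fix a countably infinite set $\mathbb P$ of propositional variables. The language $\mathcal L_\Diamond$ is given by $\varphi::=\bot\mid p\mid \varphi\wedge\varphi\mid\varphi\vee\varphi\mid\varphi\to\varphi\mid{\circ}\varphi\mid\Diamond\varphi$ with $p\in\mathbb P$; $\neg\varphi:=\varphi\to\bot$, $\top:=\neg\bot$, $\varphi\leftrightarrow\psi:=(\varphi\to\psi)\wedge(\psi\to\varphi)$. A dynamical system is a triple $(X,\mathcal T,f)$ with $(X,\mathcal T)$ a topological space and $f:X\to X$ continuous. A valuation is a map $[\![\cdot]\!]$ from formulas to open sets with $[\![\bot]\!]=\varnothing$, $[\![p]\!]\in\mathcal T$ arbitrary, $[\![\varphi\wedge\psi]\!]=[\![\varphi]\!]\cap[\![\psi]\!]$, $[\![\varphi\vee\psi]\!]=[\![\varphi]\!]\cup[\![\psi]\!]$, $[\![\varphi\to\psi]\!]$ = interior of $(X\setminus[\![\varphi]\!])\cup[\![\psi]\!]$, $[\![{\circ}\varphi]\!]=f^{ -1}[\![\varphi]\!]$, $[\![\Diamond\varphi]\!]=\bigcup_{n<\omega}f^{ -n}[\![\varphi]\!]$. A formula is valid on a dynamical system if $[\![\varphi]\!]=X$ for every valuation, and valid over a class if valid on each member. The logic ${\sf ITL}^0_\Diamond$ is the least set of $\mathcal L_\Diamond$-formulas containing all substitution instances of the axioms of intuitionistic propositional logic and of: (N1)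 $\neg{\circ}\bot$; (N2) ${\circ}\varphi\wedge{\circ}\psi\to{\circ}(\varphi\wedge\psi)$; (N3) ${\circ}(\varphi\vee\psi)\to{\circ}\varphi\vee{\circ}\psi$; (N4) ${\circ}(\varphi\to\psi)\to({\circ}\varphi\to{\circ}\psi)$; (E1) $\varphi\vee{\circ}\Diamond\varphi\to\Diamond\varphi$; and closed under the rules: modus ponens (from $\varphi$ and $\varphi\to\psi$ infer $\psi$); from $\varphi$ infer ${\circ}\varphi$; from $\varphi\to\psi$ infer $\Diamond\varphi\to\Diamond\psi$; from ${\circ}\varphi\to\varphi$ infer $\Diamond\varphi\to\varphi$. -}

module Defs where

open import Level using (Level; Lift; lift) renaming (zero to lzero; suc to lsuc)
open import Data.Nat using (ℕ; zero; suc)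
open import Data.Unit using (⊤)
open import Data.Empty using (⊥)
open import Data.Product using (Σ; _×_; _,_)
open import Data.Sum using (_⊎_)

Var : Set
Var = ℕ

infixr 5 _⇒_
infixr 6 _∨_
infixr 7 _∧_

data Form : Set where
  ⊥'  : Form
  var : Var → Form
  _∧_ : Form → Form → Form
  _∨_ : Form → Form → Form
  _⇒_ : Form → Form → Form
  ○   : Form → Form
  ◇   : Form → Form

¬' : Form → Form
¬' φ = φ ⇒ ⊥'

data ⊢_ : Form → Set where
  ax-K    : ∀ {φ ψ} → ⊢ (φ ⇒ ψ ⇒ φ)
  ax-S    : ∀ {φ ψ χ} → ⊢ ((φ ⇒ ψ ⇒ χ) ⇒ (φ ⇒ ψ) ⇒ φ ⇒ χ)
  ax-∧I   : ∀ {φ ψ} → ⊢ (φ ⇒ ψ ⇒ φ ∧ ψ)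
  ax-∧E₁  : ∀ {φ ψ} → ⊢ (φ ∧ ψ ⇒ φ)
  ax-∧E₂  : ∀ {φ ψ} → ⊢ (φ ∧ ψ ⇒ ψ)
  ax-∨I₁  : ∀ {φ ψ} → ⊢ (φ ⇒ φ ∨ ψ)
  ax-∨I₂  : ∀ {φ ψ} → ⊢ (ψ ⇒ φ ∨ ψ)
  ax-∨E   : ∀ {φ ψ χ} → ⊢ ((φ ⇒ χ) ⇒ (ψ ⇒ χ) ⇒ φ ∨ ψ ⇒ χ)
  ax-⊥E   : ∀ {φ} → ⊢ (⊥' ⇒ φ)
  ax-N1   : ⊢ ¬' (○ ⊥')
  ax-N2   : ∀ {φ ψ} → ⊢ (○ φ ∧ ○ ψ ⇒ ○ (φ ∧ ψ))
  ax-N3   : ∀ {φ ψ} → ⊢ (○ (φ ∨ ψ) ⇒ ○ φ ∨ ○ ψ)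
  ax-N4   : ∀ {φ ψ} → ⊢ (○ (φ ⇒ ψ) ⇒ ○ φ ⇒ ○ ψ)
  ax-E1   : ∀ {φ} → ⊢ (φ ∨ ○ (◇ φ) ⇒ ◇ φ)
  mp      : ∀ {φ ψ} → ⊢ φ → ⊢ (φ ⇒ ψ) → ⊢ ψ
  nec     : ∀ {φ} → ⊢ φ → ⊢ ○ φ
  ◇-mono  : ∀ {φ ψ} → ⊢ (φ ⇒ ψ) → ⊢ (◇ φ ⇒ ◇ ψ)
  ◇-ind   : ∀ {φ} → ⊢ (○ φ ⇒ φ) → ⊢ (◇ φ ⇒ φ)

record Topology (X : Set) : Set₁ where
  field
    Open     : (X → Set) → Set
    Open-ext : ∀ {U V : X → Set} → (∀ x → U x → V x) → (∀ x → V x → U x)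
               → Open U → Open V
    Open-⊤   : Open (λ _ → ⊤)
    Open-∩   : ∀ {U V} → Open U → Open V → Open (λ x → U x × V x)
    Open-⋃   : ∀ (I : Set) (U : I → X → Set) → (∀ i → Open (U i))
               → Open (λ x → Σ I (λ i → U i x))

record DynSys : Set₁ where
  field
    Carrier  : Set
    topology : Topology Carrier
    f        : Carrier → Carrier
  open Topology topology public
  field
    continuous : ∀ {U} → Open U → Open (λ x → U (f x))

iter : {X : Set} → (X → X) → ℕ → X → X
iter g zero    x = x
iter g (suc n) x = g (iter g n x)

module _ (𝔛 : DynSys) where
  open DynSys 𝔛

  Valuation : Set₁
  Valuation = Σ (Var → Carrier → Set) (λ V → ∀ p → Open (V p))

  Int : (Carrier → Set₁) → Carrier → Set₁
  Int A x = Σ (Carrier → Set) (λ U → Open U × (∀ y → U y → A y) × U x)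

  ⟦_⟧ : Form → Valuation → Carrier → Set₁
  ⟦ ⊥'    ⟧ v x = Lift (lsuc lzero) ⊥
  ⟦ var p ⟧ (V , _) x = Lift (lsuc lzero) (V p x)
  ⟦ φ ∧ ψ ⟧ v x = ⟦ φ ⟧ v x × ⟦ ψ ⟧ v x
  ⟦ φ ∨ ψ ⟧ v x = ⟦ φ ⟧ v x ⊎ ⟦ ψ ⟧ v x
  ⟦ φ ⇒ ψ ⟧ v x = Int (λ y → ⟦ φ ⟧ v y → ⟦ ψ ⟧ v y) x
  ⟦ ○ φ   ⟧ v x = ⟦ φ ⟧ v (f x)
  ⟦ ◇ φ   ⟧ v x = Σ ℕ (λ n → ⟦ φ ⟧ v (iter f n x))

ValidOn : DynSys → Form → Set₁
ValidOn 𝔛 φ = ∀ (v : Valuation 𝔛) (x : DynSys.Carrier 𝔛) → ⟦_⟧ 𝔛 φ v x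

Valid : Form → Set₁
Valid φ = ∀ (𝔛 : DynSys) → ValidOn 𝔛 φ

{-# OPTIONS --safe #-}

-- A tree (L, cs) of sets of subformulas of φ, strictly increasing along branches, has a formula Sim saying
-- that it is not realised: ⋀ L → ⋁ (Ψ ∖ L) ∨ ⋁ Sim c. There are finitely many trees. If every temporal successor
-- v of w satisfies Γ → ○ Sim v, then Γ → Sim w; so a tree without a surviving successor, or with a ◇ obligation
-- that no surviving tree reachable from it meets, has a derivable Sim (the latter by the induction rule for ◇),
-- and can be discarded. Once nothing more can be discarded, either all trees refuting φ are gone, and φ is
-- derivable, or one survives, and the space of fair infinite paths through the survivors, with the shift,
-- refutes φ. Everything is finite or decidable, so the argument needs no classical logic.

module Submission where

open import Data.Empty using (⊥; ⊥-elim)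
open import Data.List using (List; []; _∷_; _++_; map; filter; concatMap; length)
open import Data.List.Properties using (length-filter)
open import Data.List.Membership.Propositional using (_∈_; _∉_; find; lose)
open import Data.List.Membership.Propositional.Properties
  using (∈-map⁺; ∈-map⁻; ∈-++⁺ˡ; ∈-++⁺ʳ; ∈-++⁻; ∈-concatMap⁺; ∈-concatMap⁻; ∈-filter⁺; ∈-filter⁻)
import Data.List.Membership.DecPropositional as DecMembership
import Data.List.Relation.Binary.Subset.DecPropositional as DecSubset
open import Data.List.Relation.Binary.Subset.Propositional using (_⊆_)
open import Data.List.Relation.Unary.All as All using (All; []; _∷_)
open import Data.List.Relation.Unary.Any using (Any; here; there; any?)
open import Data.Maybe using (Maybe; just; nothing; _>>=_)
import Data.Nat as ℕ
open import Data.Nat using (ℕ; zero; suc; _+_; _≤_; _<_; z≤n; s≤s; _⊔_; _<?_)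
open import Data.Nat.Properties
  using (≤-refl; ≤-trans; <-≤-trans; n≤1+n; m≤n⇒m≤1+n; m≤m⊔n; m≤n⊔m; ≤-pred; +-suc; +-identityʳ; m≤n⇒m<n∨m≡n; n<1+n)
open import Data.Product using (Σ-syntax; ∃-syntax; _×_; _,_; proj₁; proj₂)
open import Data.Sum using (_⊎_; inj₁; inj₂; [_,_]′)
open import Data.Unit using (⊤; tt)
open import Level using (lift)
open import Relation.Binary.Definitions using (DecidableEquality)
open import Relation.Binary.PropositionalEquality using (_≡_; refl; sym; trans; cong; subst)
open import Relation.Nullary using (¬_; Dec; yes; no)
open import Relation.Nullary.Decidable using (toSum; _×-dec_; _→-dec_; _⊎-dec_)

open import Defs

-- Decidable equality of formulas.

same? : (a b : Form) → Maybe (a ≡ b)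
same? ⊥' ⊥' = just refl
same? (var p) (var q) with p ℕ.≟ q
... | yes refl = just refl
... | no _     = nothing
same? (a ∧ b) (c ∧ d) = do refl ← same? a c; refl ← same? b d; just refl
same? (a ∨ b) (c ∨ d) = do refl ← same? a c; refl ← same? b d; just refl
same? (a ⇒ b) (c ⇒ d) = do refl ← same? a c; refl ← same? b d; just refl
same? (○ a) (○ b) = do refl ← same? a b; just refl
same? (◇ a) (◇ b) = do refl ← same? a b; just refl
same? _ _ = nothing

-- Only positive answers of `same?` carry evidence, which avoids refuting every mismatched pair of
-- constructors. Reflexivity is what later turns `nothing` into a refutation.
same?-refl : ∀ a → same? a a ≡ just refl
same?-refl ⊥' = refl
same?-refl (var p) with p ℕ.≟ p
... | yes refl = refl
... | no p≢p   = ⊥-elim (p≢p refl)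
same?-refl (a ∧ b) rewrite same?-refl a | same?-refl b = refl
same?-refl (a ∨ b) rewrite same?-refl a | same?-refl b = refl
same?-refl (a ⇒ b) rewrite same?-refl a | same?-refl b = refl
same?-refl (○ a) rewrite same?-refl a = refl
same?-refl (◇ a) rewrite same?-refl a = refl

_≟_ : DecidableEquality Form
a ≟ b with same? a b in eq
... | just a≡b = yes a≡b
... | nothing  = no λ { refl → nothing≢just (trans (sym eq) (same?-refl a)) }
  where
  nothing≢just : ∀ {A : Set} {x : A} → nothing ≡ just x → ⊥
  nothing≢just ()

open DecMembership _≟_ using (_∈?_; _∉?_)
open DecSubset _≟_ using (_⊆?_)

-- Derivability as a preorder: intuitionistic and temporal laws.

infix 4 _⊑_

_⊑_ : Form → Form → Set
a ⊑ b = ⊢ (a ⇒ b)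

weaken : ∀ {a b} → ⊢ b → a ⊑ b
weaken p = mp p ax-K

infixl 5 _$⊑_

_$⊑_ : ∀ {a b c} → a ⊑ b ⇒ c → a ⊑ b → a ⊑ c
p $⊑ q = mp q (mp p ax-S)

⊑-refl : ∀ {a} → a ⊑ a
⊑-refl {a} = ax-K $⊑ ax-K {a} {a}

⊑-trans : ∀ {a b c} → a ⊑ b → b ⊑ c → a ⊑ c
⊑-trans p q = weaken q $⊑ p

∧-glb : ∀ {a b c} → a ⊑ b → a ⊑ c → a ⊑ b ∧ c
∧-glb p q = weaken ax-∧I $⊑ p $⊑ q

∨-lub : ∀ {a b c} → a ⊑ c → b ⊑ c → a ∨ b ⊑ c
∨-lub p q = mp q (mp p ax-∨E)

∨-mono : ∀ {a b c d} → a ⊑ c → b ⊑ d → a ∨ b ⊑ c ∨ d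
∨-mono p q = ∨-lub (⊑-trans p ax-∨I₁) (⊑-trans q ax-∨I₂)

curry⊑ : ∀ {a b c} → a ∧ b ⊑ c → a ⊑ b ⇒ c
curry⊑ p = weaken (mp (weaken p) ax-S) $⊑ ax-∧I

-- The case distinction on `b` that survives intuitionistically: `b` joins either the premises or
-- the disjunction on the right.
cut : ∀ {a b c} → a ∧ b ⊑ c → a ⊑ c ∨ b → a ⊑ c
cut p q = weaken ax-∨E $⊑ weaken ⊑-refl $⊑ curry⊑ p $⊑ q

⊤' : Form
⊤' = ⊥' ⇒ ⊥'

⋀ : List Form → Form
⋀ []       = ⊤'
⋀ (a ∷ as) = a ∧ ⋀ as

⋁ : List Form → Form
⋁ []       = ⊥'
⋁ (a ∷ as) = a ∨ ⋁ as

⋀-lb : ∀ {a as} → a ∈ as → ⋀ as ⊑ a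
⋀-lb (here refl) = ax-∧E₁
⋀-lb (there m)   = ⊑-trans ax-∧E₂ (⋀-lb m)

⋀-glb : ∀ {a} as → (∀ {b} → b ∈ as → a ⊑ b) → a ⊑ ⋀ as
⋀-glb []       f = weaken ⊑-refl
⋀-glb (b ∷ as) f = ∧-glb (f (here refl)) (⋀-glb as (λ m → f (there m)))

⋁-ub : ∀ {a as} → a ∈ as → a ⊑ ⋁ as
⋁-ub (here refl) = ax-∨I₁
⋁-ub (there m)   = ⊑-trans (⋁-ub m) ax-∨I₂

⋁-lub : ∀ {a} as → (∀ {b} → b ∈ as → b ⊑ a) → ⋁ as ⊑ a
⋁-lub []       f = ax-⊥E
⋁-lub (b ∷ as) f = ∨-lub (f (here refl)) (⋁-lub as (λ m → f (there m)))

○-mono : ∀ {a b} → a ⊑ b → ○ a ⊑ ○ b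
○-mono p = mp (nec p) ax-N4

-- The converse of E1, by induction: `a ∨ ○ (◇ a)` is closed under `○`, since E1 under `○` sends it
-- to `○ (◇ a)`.
◇-unfold : ∀ {a} → ◇ a ⊑ a ∨ ○ (◇ a)
◇-unfold = ⊑-trans (◇-mono ax-∨I₁) (◇-ind (⊑-trans (○-mono ax-E1) ax-∨I₂))

-- Applied with h the identity and h = ○; Γ₀ and G₀ accumulate the formulas decided so far.
decide : (h : Form → Form) →
         (∀ {a b} → h a ∧ h b ⊑ h (a ∧ b)) → (∀ {a b} → h (a ∨ b) ⊑ h a ∨ h b) →
         (Ξ : List Form) → ∀ {Γ G Γ₀ G₀} → Γ ⊑ h Γ₀ → h G₀ ⊑ G →
         (∀ {Γ′ G′ Γ₁ G₁} → Γ′ ⊑ Γ → G ⊑ G′ → Γ₁ ⊑ Γ₀ → G₀ ⊑ G₁ → Γ′ ⊑ h Γ₁ → h G₁ ⊑ G′ →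
           (∀ {ξ} → ξ ∈ Ξ → Γ₁ ⊑ ξ ⊎ ξ ⊑ G₁) → Γ′ ⊑ G′) →
         Γ ⊑ G
decide h h∧ h∨ [] p q k = k ⊑-refl ⊑-refl ⊑-refl ⊑-refl p q (λ ())
decide h h∧ h∨ (ξ ∷ Ξ) {Γ} {G} {Γ₀} {G₀} p q k = cut left right
  where
  left : Γ ∧ h ξ ⊑ G
  left = decide h h∧ h∨ Ξ {Γ₀ = Γ₀ ∧ ξ} {G₀} (⊑-trans (∧-glb (⊑-trans ax-∧E₁ p) ax-∧E₂) h∧) q
    λ r s t u v w d → k (⊑-trans r ax-∧E₁) s (⊑-trans t ax-∧E₁) u v w
      λ { (here refl) → inj₁ (⊑-trans t ax-∧E₂) ; (there m) → d m }
  right : Γ ⊑ G ∨ h ξ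
  right = decide h h∧ h∨ Ξ {Γ₀ = Γ₀} {G₀ ∨ ξ} p (⊑-trans h∨ (∨-mono q ⊑-refl))
    λ r s t u v w d → k r (⊑-trans ax-∨I₁ s) t (⊑-trans ax-∨I₁ u) v w
      λ { (here refl) → inj₂ (⊑-trans ax-∨I₂ u) ; (there m) → d m }

-- Subformulas and their closure.

infix 4 _◁_

data _◁_ : Form → Form → Set where
  ∧ˡ : ∀ {a b} → a ◁ a ∧ b
  ∧ʳ : ∀ {a b} → b ◁ a ∧ b
  ∨ˡ : ∀ {a b} → a ◁ a ∨ b
  ∨ʳ : ∀ {a b} → b ◁ a ∨ b
  ⇒ˡ : ∀ {a b} → a ◁ (a ⇒ b)
  ⇒ʳ : ∀ {a b} → b ◁ (a ⇒ b)
  ○◁ : ∀ {a} → a ◁ ○ a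
  ◇◁ : ∀ {a} → a ◁ ◇ a

proper sub : Form → List Form
proper ⊥'      = []
proper (var p) = []
proper (a ∧ b) = sub a ++ sub b
proper (a ∨ b) = sub a ++ sub b
proper (a ⇒ b) = sub a ++ sub b
proper (○ a)   = sub a
proper (◇ a)   = sub a
sub a = a ∷ proper a

sub-refl : ∀ a → a ∈ sub a
sub-refl ⊥'      = here refl
sub-refl (var p) = here refl
sub-refl (a ∧ b) = here refl
sub-refl (a ∨ b) = here refl
sub-refl (a ⇒ b) = here refl
sub-refl (○ a)   = here refl
sub-refl (◇ a)   = here refl

◁⇒proper : ∀ {a b} → a ◁ b → a ∈ proper b
◁⇒proper ∧ˡ           = ∈-++⁺ˡ (sub-refl _)
◁⇒proper (∧ʳ {a})     = ∈-++⁺ʳ (sub a) (sub-refl _)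
◁⇒proper ∨ˡ           = ∈-++⁺ˡ (sub-refl _)
◁⇒proper (∨ʳ {a})     = ∈-++⁺ʳ (sub a) (sub-refl _)
◁⇒proper ⇒ˡ           = ∈-++⁺ˡ (sub-refl _)
◁⇒proper (⇒ʳ {a})     = ∈-++⁺ʳ (sub a) (sub-refl _)
◁⇒proper ○◁           = sub-refl _
◁⇒proper ◇◁           = sub-refl _

sub-closed : ∀ c {a b} → b ∈ sub c → a ◁ b → a ∈ sub c
proper-closed : ∀ c {a b} → b ∈ proper c → a ◁ b → a ∈ proper c
++-closed : ∀ c d {a b} → b ∈ sub c ++ sub d → a ◁ b → a ∈ sub c ++ sub d
sub-closed c (here refl) r = there (◁⇒proper r)
sub-closed c (there m)   r = there (proper-closed c m r)
proper-closed (c ∧ d) = ++-closed c d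
proper-closed (c ∨ d) = ++-closed c d
proper-closed (c ⇒ d) = ++-closed c d
proper-closed (○ c)   = sub-closed c
proper-closed (◇ c)   = sub-closed c
++-closed c d m r with ∈-++⁻ (sub c) m
... | inj₁ m′ = ∈-++⁺ˡ (sub-closed c m′ r)
... | inj₂ m′ = ∈-++⁺ʳ (sub c) (sub-closed d m′ r)

-- Finite search through lists.

module _ {A : Set} where

  sublists : List A → List (List A)
  sublists []       = [] ∷ []
  sublists (x ∷ xs) = map (x ∷_) (sublists xs) ++ sublists xs

  sublists-⊆ : ∀ {xs ys} → ys ∈ sublists xs → ys ⊆ xs
  sublists-⊆ {[]} (here refl) ()
  sublists-⊆ {x ∷ xs} m with ∈-++⁻ (map (x ∷_) (sublists xs)) m
  ... | inj₂ m′ = λ y∈ → there (sublists-⊆ m′ y∈)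
  ... | inj₁ m′ with ∈-map⁻ (x ∷_) m′
  ...   | zs , zs∈ , refl = λ { (here y≡x) → here y≡x ; (there y∈) → there (sublists-⊆ zs∈ y∈) }

  choose : {P Q : A → Set} → ∀ xs → (∀ {x} → x ∈ xs → P x ⊎ Q x) →
           ∃[ ys ] ys ∈ sublists xs × (∀ {x} → x ∈ ys → P x) × (∀ {x} → x ∈ xs → x ∈ ys ⊎ Q x)
  choose [] f = [] , here refl , (λ ()) , λ ()
  choose (x ∷ xs) f with f (here refl) | choose xs (λ m → f (there m))
  ... | inj₁ p | ys , ys∈ , all-P , rest =
    x ∷ ys , ∈-++⁺ˡ (∈-map⁺ (x ∷_) ys∈)
    , (λ { (here refl) → p ; (there m) → all-P m })
    , λ { (here refl) → inj₁ (here refl) ; (there m) → [ (λ y → inj₁ (there y)) , inj₂ ]′ (rest m) }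
  ... | inj₂ q | ys , ys∈ , all-P , rest =
    ys , ∈-++⁺ʳ (map (x ∷_) (sublists xs)) ys∈ , all-P
    , λ { (here refl) → inj₂ q ; (there m) → rest m }

  -- `Z` is an escape: typically a derivation such as `Γ ⊑ G`, which settles the goal at once.
  all-or : {P : A → Set} {Z : Set} → ∀ xs → (∀ {x} → x ∈ xs → P x ⊎ Z) → All P xs ⊎ Z
  all-or []       f = inj₁ []
  all-or (x ∷ xs) f with f (here refl) | all-or xs (λ m → f (there m))
  ... | inj₂ z | _       = inj₂ z
  ... | inj₁ p | inj₂ z  = inj₂ z
  ... | inj₁ p | inj₁ ps = inj₁ (p ∷ ps)

  -- One occurrence is removed; the length equation pays for the recursion of the elimination
  -- arguments.
  all-or-remove : {P Q : A → Set} → ∀ xs → (∀ {x} → x ∈ xs → P x ⊎ Q x) →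
                  (∀ {x} → x ∈ xs → P x) ⊎
                  (∃[ x ] ∃[ ys ] x ∈ xs × Q x × ys ⊆ xs × length xs ≡ suc (length ys) ×
                    (∀ {y} → y ∈ xs → y ≡ x ⊎ y ∈ ys))
  all-or-remove [] f = inj₁ λ ()
  all-or-remove (x ∷ xs) f with f (here refl) | all-or-remove xs (λ m → f (there m))
  ... | inj₂ q | _ = inj₂ (x , xs , here refl , q , there , refl , λ { (here e) → inj₁ e ; (there m) → inj₂ m })
  ... | inj₁ p | inj₁ ps = inj₁ λ { (here refl) → p ; (there m) → ps m }
  ... | inj₁ p | inj₂ (y , ys , y∈ , q , ys⊆ , len , cover) =
    inj₂ (y , x ∷ ys , there y∈ , q
         , (λ { (here e) → here e ; (there m) → there (ys⊆ m) }) , cong suc len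
         , λ { (here e) → inj₂ (here e) ; (there m) → [ inj₁ , (λ n → inj₂ (there n)) ]′ (cover m) })

module _ {Z : Set} where

  infixr 2 _×ᶻ_

  _×ᶻ_ : {A B : Set} → A ⊎ Z → B ⊎ Z → (A × B) ⊎ Z
  inj₂ z ×ᶻ _      = inj₂ z
  inj₁ a ×ᶻ inj₂ z = inj₂ z
  inj₁ a ×ᶻ inj₁ b = inj₁ (a , b)

  -- Deciding `A` first is what lets the escape be pulled out of the function constructively.
  →ᶻ : {A B : Set} → Dec A → (A → B ⊎ Z) → (A → B) ⊎ Z
  →ᶻ (no ¬a) f = inj₁ λ a → ⊥-elim (¬a a)
  →ᶻ (yes a) f with f a
  ... | inj₁ b = inj₁ λ _ → b
  ... | inj₂ z = inj₂ z

-- Finite labelled trees and their intuitionistic order.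

data Tree : Set where
  node : List Form → List Tree → Tree

label : Tree → List Form
label (node L cs) = L

kids : Tree → List Tree
kids (node L cs) = cs

desc : Tree → List Tree
descs : List Tree → List Tree
desc (node L cs) = node L cs ∷ descs cs
descs []       = []
descs (c ∷ cs) = desc c ++ descs cs

infix 4 _≽_

_≽_ : Tree → Tree → Set
u ≽ v = u ∈ desc v

≽-refl : ∀ {v} → v ≽ v
≽-refl {node L cs} = here refl

descs⁺ : ∀ {u c cs} → c ∈ cs → u ≽ c → u ∈ descs cs
descs⁺ (here refl)        u≽c = ∈-++⁺ˡ u≽c
descs⁺ {cs = d ∷ _} (there m) u≽c = ∈-++⁺ʳ (desc d) (descs⁺ m u≽c)

descs⁻ : ∀ {u} cs → u ∈ descs cs → ∃[ c ] c ∈ cs × u ≽ c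
descs⁻ (c ∷ cs) m with ∈-++⁻ (desc c) m
... | inj₁ u≽c = c , here refl , u≽c
... | inj₂ m′ with descs⁻ cs m′
...   | d , d∈ , u≽d = d , there d∈ , u≽d

kid-≽ : ∀ {v c} → c ∈ kids v → c ≽ v
kid-≽ {node L cs} m = there (descs⁺ m ≽-refl)

≽-trans : ∀ {u v w} → u ≽ v → v ≽ w → u ≽ w
descs-trans : ∀ {u v} cs → u ≽ v → v ∈ descs cs → u ∈ descs cs
≽-trans {w = node L cs} u≽v (here refl) = u≽v
≽-trans {w = node L cs} u≽v (there m)   = there (descs-trans cs u≽v m)
descs-trans (c ∷ cs) u≽v m with ∈-++⁻ (desc c) m
... | inj₁ v≽c = ∈-++⁺ˡ (≽-trans u≽v v≽c)
... | inj₂ m′  = ∈-++⁺ʳ (desc c) (descs-trans cs u≽v m′)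

module _ {Q : Tree → Set} (Q-kid : ∀ {v c} → Q v → c ∈ kids v → Q c × label v ⊆ label c) where

  ≽-hereditary : ∀ {u} v → Q v → u ≽ v → Q u × label v ⊆ label u
  descs-hereditary : ∀ {u L} cs → (∀ {c} → c ∈ cs → Q c × L ⊆ label c) → u ∈ descs cs → Q u × L ⊆ label u
  ≽-hereditary (node L cs) q (here refl) = q , λ m → m
  ≽-hereditary (node L cs) q (there m)   = descs-hereditary cs (Q-kid q) m
  descs-hereditary (c ∷ cs) f m with ∈-++⁻ (desc c) m
  ... | inj₂ m′  = descs-hereditary cs (λ c∈ → f (there c∈)) m′
  ... | inj₁ u≽c with ≽-hereditary c (proj₁ (f (here refl))) u≽c
  ...   | Qu , c⊆u = Qu , λ m → c⊆u (proj₂ (f (here refl)) m)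

-- Simulation formulas of trees.

module Filtration (Ψ : List Form) (closed : ∀ {a b : Form} → b ∈ Ψ → a ◁ b → a ∈ Ψ) where

  missing : List Form → List Form → List Form
  missing L = filter (_∉? L)

  -- A Jankov-style formula. In a Kripke model a point refutes it when some point above satisfies
  -- all of `L`, nothing else of `Ψ`, and refutes the formula of every kid.
  Sim : Tree → Form
  sims : List Tree → Form
  Sim (node L cs) = ⋀ L ⇒ ⋁ (missing L Ψ) ∨ sims cs
  sims []       = ⊥'
  sims (c ∷ cs) = Sim c ∨ sims cs

  sims-ub : ∀ {c cs} → c ∈ cs → Sim c ⊑ sims cs
  sims-ub (here refl) = ax-∨I₁
  sims-ub (there m)   = ⊑-trans (sims-ub m) ax-∨I₂

  sims-lub : ∀ {a} cs → (∀ {c} → c ∈ cs → Sim c ⊑ a) → sims cs ⊑ a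
  sims-lub []       f = ax-⊥E
  sims-lub (c ∷ cs) f = ∨-lub (f (here refl)) (sims-lub cs (λ m → f (there m)))

  missing-⊑Sim : ∀ {a} v → a ∈ Ψ → a ∉ label v → a ⊑ Sim v
  missing-⊑Sim (node L cs) a∈ a∉ =
    ⊑-trans (⊑-trans (⋁-ub (∈-filter⁺ (_∉? L) a∈ a∉)) ax-∨I₁) ax-K

  kid-⊑Sim : ∀ {c} v → c ∈ kids v → Sim c ⊑ Sim v
  kid-⊑Sim (node L cs) c∈ = ⊑-trans (⊑-trans (sims-ub c∈) ax-∨I₂) ax-K

  -- The deduction theorem in continuation form: the disjunction on the right is hidden as a `G`
  -- known only through what lies below it.
  ⊑Sim-intro : ∀ {Γ} v →
    (∀ {Γ′ G} → Γ′ ⊑ Γ → (∀ {a} → a ∈ label v → Γ′ ⊑ a) → (∀ {a} → a ∈ Ψ → a ∉ label v → a ⊑ G) →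
      (∀ {c} → c ∈ kids v → Sim c ⊑ G) → Γ′ ⊑ G) →
    Γ ⊑ Sim v
  ⊑Sim-intro (node L cs) f = curry⊑ (f ax-∧E₁ (λ a∈ → ⊑-trans ax-∧E₂ (⋀-lb a∈))
    (λ a∈ a∉ → ⊑-trans (⋁-ub (∈-filter⁺ (_∉? L) a∈ a∉)) ax-∨I₁)
    (λ c∈ → ⊑-trans (sims-ub c∈) ax-∨I₂))

  -- The pair (Γ, G) stands for a prime theory containing Γ and not G; no such theory need be constructed.
  record Describes (Γ G : Form) (v : Tree) : Set where
    field
      positive : ∀ {a} → a ∈ label v → Γ ⊑ a
      negative : ∀ {a} → a ∈ Ψ → a ∈ label v ⊎ a ⊑ G
      kids⊑    : ∀ {c} → c ∈ kids v → Sim c ⊑ G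

    negative′ : ∀ {a} → a ∈ Ψ → a ∉ label v → a ⊑ G
    negative′ a∈ a∉ = [ (λ m → ⊥-elim (a∉ m)) , (λ p → p) ]′ (negative a∈)

  -- Modus ponens: `Γ` yields the premise of `Sim v`, and each disjunct of its conclusion lies below
  -- `G`. Thus `Γ ⊑ Sim v` makes the pair inconsistent, `Γ ⊑ G`.
  refute : ∀ {Γ G} v → Describes Γ G v → Sim v ∧ Γ ⊑ G
  refute (node L cs) D = ⊑-trans (ax-∧E₁ $⊑ ⋀-glb L (λ a∈ → ⊑-trans ax-∧E₂ (positive a∈)))
    (∨-lub (⋁-lub _ (λ m → let a∈ , a∉ = ∈-filter⁻ (_∉? L) m in negative′ a∈ a∉))
           (sims-lub cs kids⊑))
    where open Describes D

  -- Rank of labels and strict growth.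

  rank : List Form → ℕ
  rank L = length (missing L Ψ)

  -- The list is compared position by position, so repeated subformulas do no harm; if no position
  -- stops being missing, `L′` adds nothing from `as`.
  missing-anti : ∀ {L L′} → L ⊆ L′ → ∀ as →
    length (missing L′ as) ≤ length (missing L as) ×
    ((∀ {a} → a ∈ as → a ∈ L′ → a ∈ L) ⊎ length (missing L′ as) < length (missing L as))
  missing-anti L⊆L′ [] = z≤n , inj₁ λ ()
  missing-anti {L} {L′} L⊆L′ (a ∷ as)
    with a ∈? L | a ∈? L′ | missing-anti L⊆L′ as
  ... | yes a∈L | yes _    | le , inj₁ f  = le , inj₁ λ { (here refl) _ → a∈L ; (there m) → f m }
  ... | yes _   | yes _    | le , inj₂ lt = le , inj₂ lt
  ... | yes a∈L | no a∉L′  | _            = ⊥-elim (a∉L′ (L⊆L′ a∈L))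
  ... | no _    | yes _    | le , _       = m≤n⇒m≤1+n le , inj₂ (s≤s le)
  ... | no _    | no a∉L′  | le , inj₁ f  = s≤s le , inj₁ λ { (here refl) a∈L′ → ⊥-elim (a∉L′ a∈L′) ; (there m) → f m }
  ... | no _    | no _     | le , inj₂ lt = s≤s le , inj₂ (s≤s lt)

  rank-anti : ∀ {L L′} → L ⊆ L′ → rank L′ ≤ rank L
  rank-anti L⊆L′ = proj₁ (missing-anti L⊆L′ Ψ)

  infix 4 _⊏_

  _⊏_ : List Form → List Form → Set
  L ⊏ L′ = L ⊆ L′ × rank L′ < rank L

  _⊏?_ : ∀ L L′ → Dec (L ⊏ L′)
  L ⊏? L′ = (L ⊆? L′) ×-dec (rank L′ <? rank L)

  ⊆⇒⊇⊎⊏ : ∀ {L L′} → L ⊆ L′ → (∀ {a} → a ∈ Ψ → a ∈ L′ → a ∈ L) ⊎ L ⊏ L′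
  ⊆⇒⊇⊎⊏ L⊆L′ with proj₂ (missing-anti L⊆L′ Ψ)
  ... | inj₁ f  = inj₁ f
  ... | inj₂ lt = inj₂ ((λ {_} → L⊆L′) , lt)

  -- Legitimate trees and their finite enumeration.

  Local : List Form → List Tree → Form → Set
  Local L cs ⊥'      = ⊥' ∉ L
  Local L cs (var p) = ⊤
  Local L cs (a ∧ b) = (a ∧ b ∈ L → a ∈ L × b ∈ L) × (a ∈ L → b ∈ L → a ∧ b ∈ L)
  Local L cs (a ∨ b) = (a ∨ b ∈ L → a ∈ L ⊎ b ∈ L) × (a ∈ L → a ∨ b ∈ L) × (b ∈ L → a ∨ b ∈ L)
  -- The second component is a positive trichotomy, so that the truth lemma can split on it without
  -- excluded middle. Kids suffice as witnesses because a describing tree takes as kids all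
  -- candidates whose `Sim` lies below `G`.
  Local L cs (a ⇒ b) = (a ⇒ b ∈ L → a ∈ L → b ∈ L) ×
    (a ⇒ b ∈ L ⊎ (a ∈ L × b ∉ L) ⊎ Any (λ c → a ∈ label c × b ∉ label c) cs)
  Local L cs (○ a)   = ⊤
  Local L cs (◇ a)   = ⊤

  witness? : ∀ a b cs → Dec (Any (λ c → a ∈ label c × b ∉ label c) cs)
  witness? a b = any? (λ c → (a ∈? label c) ×-dec (b ∉? label c))

  local? : ∀ L cs a → Dec (Local L cs a)
  local? L cs ⊥'      = ⊥' ∉? L
  local? L cs (var p) = yes tt
  local? L cs (a ∧ b) = ((a ∧ b ∈? L) →-dec ((a ∈? L) ×-dec (b ∈? L)))
    ×-dec ((a ∈? L) →-dec ((b ∈? L) →-dec (a ∧ b ∈? L)))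
  local? L cs (a ∨ b) = ((a ∨ b ∈? L) →-dec ((a ∈? L) ⊎-dec (b ∈? L)))
    ×-dec ((a ∈? L) →-dec (a ∨ b ∈? L)) ×-dec ((b ∈? L) →-dec (a ∨ b ∈? L))
  local? L cs (a ⇒ b) = (((a ⇒ b) ∈? L) →-dec ((a ∈? L) →-dec (b ∈? L)))
    ×-dec (((a ⇒ b) ∈? L) ⊎-dec ((a ∈? L) ×-dec (b ∉? L)) ⊎-dec witness? a b cs)
  local? L cs (○ a)   = yes tt
  local? L cs (◇ a)   = yes tt

  Legit : Tree → Set
  Legit v = All (Local (label v) (kids v)) Ψ

  candidates : List Form → List Tree → List Tree
  candidates L = filter (λ c → L ⊏? label c)

  legit? : ∀ v → Dec (Legit v)
  legit? v = All.all? (local? (label v) (kids v)) Ψ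

  layer : List Tree → List Form → List Tree
  layer T L = map (node L) (sublists (candidates L T))

  -- Stage `k` adds the trees whose root has rank `k`, with kids from earlier stages; rank falls
  -- strictly from a tree to its kids.
  trees new-trees : ℕ → List Tree
  trees zero    = []
  trees (suc k) = new-trees k ++ trees k
  new-trees k = filter legit? (concatMap (layer (trees k)) (filter (λ L → rank L ℕ.≟ k) (sublists Ψ)))

  data New (k : ℕ) : Tree → Set where
    new : ∀ {L cs} → L ∈ sublists Ψ → rank L ≡ k → cs ∈ sublists (candidates L (trees k)) →
          Legit (node L cs) → New k (node L cs)

  trees-new : ∀ {k v} → New k v → v ∈ trees (suc k)
  trees-new {k} (new L∈ r cs∈ l) = ∈-++⁺ˡ (∈-filter⁺ legit?
    (∈-concatMap⁺ (layer (trees k)) (lose (∈-filter⁺ (λ L → rank L ℕ.≟ k) L∈ r) (∈-map⁺ (node _) cs∈))) l)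

  trees-inv : ∀ {k v} → v ∈ trees (suc k) → New k v ⊎ v ∈ trees k
  trees-inv {k} m with ∈-++⁻ (new-trees k) m
  ... | inj₂ m′ = inj₂ m′
  ... | inj₁ m′ with ∈-filter⁻ legit? m′
  ...   | m″ , l with find (∈-concatMap⁻ (layer (trees k)) m″)
  ...     | L , L∈ , v∈ with ∈-map⁻ (node L) v∈ | ∈-filter⁻ (λ L → rank L ℕ.≟ k) {xs = sublists Ψ} L∈
  ...       | cs , cs∈ , refl | L∈′ , r = inj₁ (new L∈′ r cs∈ l)

  trees-mono : ∀ {j k} → j ≤ k → trees j ⊆ trees k
  trees-mono {j} {k} j≤k m with m≤n⇒m<n∨m≡n j≤k
  trees-mono _ m | inj₂ refl = m
  trees-mono {k = suc k} _ m | inj₁ (s≤s j≤k) = ∈-++⁺ʳ (new-trees k) (trees-mono j≤k m)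

  -- The rank of its root alone fixes the stage at which a tree enters.
  trees-by-rank : ∀ {j k v} → v ∈ trees j → rank (label v) < k → v ∈ trees k
  trees-by-rank {suc j} m lt with trees-inv {j} m
  ... | inj₂ m′ = trees-by-rank {j} m′ lt
  ... | inj₁ (new _ refl _ _) = trees-mono lt m

  all-trees : List Tree
  -- Ranks run from 0 to `length Ψ` inclusive, hence the successor.
  all-trees = trees (suc (length Ψ))

  record WellFormed (v : Tree) : Set where
    field
      legit    : Legit v
      label⊆   : label v ⊆ Ψ
      kid∈     : ∀ {c} → c ∈ kids v → c ∈ all-trees
      kid-⊏    : ∀ {c} → c ∈ kids v → label v ⊏ label c

  well-formed : ∀ {v} → v ∈ all-trees → WellFormed v
  well-formed = go (suc (length Ψ)) ≤-refl
    where
    go : ∀ k {v} → k ≤ suc (length Ψ) → v ∈ trees k → WellFormed v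
    go (suc k) le m with trees-inv {k} m
    ... | inj₂ m′ = go k (≤-trans (n≤1+n k) le) m′
    ... | inj₁ (new {L} {cs} L∈ r cs∈ l) = record
      { legit  = l
      ; label⊆ = sublists-⊆ L∈
      ; kid∈   = λ c∈ → trees-mono (≤-trans (n≤1+n k) le) (proj₁ (candidate c∈))
      ; kid-⊏  = λ c∈ → proj₂ (candidate c∈) }
      where
      candidate : ∀ {c} → c ∈ cs → c ∈ trees k × L ⊏ label c
      candidate c∈ = ∈-filter⁻ (λ c → L ⊏? label c) (sublists-⊆ cs∈ c∈)

  -- Trees describing decided pairs.

  decisive : List Form
  decisive = Ψ ++ map Sim all-trees

  Decided : Form → Form → Set
  Decided Γ G = ∀ {ξ} → ξ ∈ decisive → Γ ⊑ ξ ⊎ ξ ⊑ G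

  -- `maximal` makes the tree as wide as possible: a strictly larger tree that is not a kid has its
  -- `Sim` on the side of `Γ`.
  record Describing (Γ G : Form) (v : Tree) : Set where
    field
      describes : Describes Γ G v
      label∈    : label v ∈ sublists Ψ
      kids∈     : kids v ∈ sublists (candidates (label v) (trees (rank (label v))))
      maximal   : ∀ {c} → c ∈ all-trees → label v ⊏ label c → c ∈ kids v ⊎ Γ ⊑ Sim c

  description : ∀ {Γ G} → Decided Γ G → ∃[ v ] Describing Γ G v
  description {Γ} {G} d with choose Ψ (λ a∈ → d (∈-++⁺ˡ a∈))
  ... | L , L∈ , pos , neg with choose {P = λ c → Sim c ⊑ G} {Q = λ c → Γ ⊑ Sim c} (candidates L (trees (rank L)))
                                  (λ c∈ → [ inj₂ , inj₁ ]′ (d (decisive-Sim c∈)))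
    where
    rank≤ : rank L ≤ length Ψ
    rank≤ = length-filter (_∉? L) Ψ
    decisive-Sim : ∀ {c} → c ∈ candidates L (trees (rank L)) → Sim c ∈ decisive
    decisive-Sim c∈ = ∈-++⁺ʳ Ψ (∈-map⁺ Sim (trees-mono {rank L} {suc (length Ψ)} (≤-trans rank≤ (n≤1+n _))
      (proj₁ (∈-filter⁻ (λ c → L ⊏? label c) c∈))))
  ...   | cs , cs∈ , ref , acc = node L cs , record
    { describes = record { positive = pos ; negative = neg ; kids⊑ = ref }
    ; label∈ = L∈ ; kids∈ = cs∈
    ; maximal = λ c∈ lt → acc (∈-filter⁺ (λ c → L ⊏? label c)
        (trees-by-rank {suc (length Ψ)} {rank L} c∈ (proj₂ lt)) lt) }

  describing∈ : ∀ {Γ G v} → Describing Γ G v → Legit v → v ∈ all-trees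
  describing∈ {v = node L cs} D l =
    trees-mono {suc (rank L)} {suc (length Ψ)} (s≤s (length-filter (_∉? L) Ψ)) (trees-new {rank L} (new (Describing.label∈ D) refl (Describing.kids∈ D) l))

  -- The substitute for extending to a prime theory: the pair may be assumed decided, at the price
  -- of a stronger `Γ` and a weaker `G`.
  decide-id : ∀ {Γ G} → (∀ {Γ′ G′} → Γ′ ⊑ Γ → G ⊑ G′ → Decided Γ′ G′ → Γ′ ⊑ G′) → Γ ⊑ G
  decide-id f = decide (λ a → a) ⊑-refl ⊑-refl decisive ⊑-refl ⊑-refl
    λ _ _ r s p q d → ⊑-trans p (⊑-trans (f r s d) q)

  -- A violated clause of `Local` always yields `Γ ⊑ G`. Only implication looks at larger labels,
  -- hence the induction on a bound for the rank.
  describing-legit : ∀ k {Γ G v} → Describing Γ G v → rank (label v) < k → Legit v ⊎ Γ ⊑ G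
  describing-legit (suc k) {Γ} {G} {node L cs} D rank<k = all-or Ψ λ {a} → local a
    where
    open Describing D
    open Describes describes

    present : ∀ {a} → a ∈ Ψ → Γ ⊑ a → a ∈ L ⊎ Γ ⊑ G
    present a∈ p = [ inj₁ , (λ q → inj₂ (⊑-trans p q)) ]′ (negative a∈)

    -- Decide `Γ ∧ a` against `b` and describe the result by `v`. Its label properly extends `L`, so
    -- `v` is legitimate by induction and hence enumerated. By `maximal` it is a kid, thus a witness
    -- unless it contains `b`, or else `Γ ⊑ Sim v`, which refutes the pair.
    unwitnessed : ∀ {a b} → (a ⇒ b) ∈ Ψ → a ∉ L → b ∉ L →
                  ¬ Any (λ c → a ∈ label c × b ∉ label c) cs → Γ ⊑ a ⇒ b
    unwitnessed {a} {b} ab∈ a∉ b∉ none = curry⊑ (decide-id λ below above d →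
      let v , D′ = description d in extend v D′ below above)
      where
      extend : ∀ {Γ′ G′} v → Describing Γ′ G′ v → Γ′ ⊑ Γ ∧ a → b ⊑ G′ → Γ′ ⊑ G′
      extend {Γ′} {G′} v D′ below above = result
        where
        module D′ = Describes (Describing.describes D′)
        present′ : ∀ {x} → x ∈ Ψ → Γ′ ⊑ x → x ∈ label v ⊎ Γ′ ⊑ G′
        present′ x∈ p = [ inj₁ , (λ q → inj₂ (⊑-trans p q)) ]′ (D′.negative x∈)
        conclude : L ⊏ label v → a ∈ label v → Legit v → Γ′ ⊑ G′
        conclude lt a∈ l with b ∈? label v | maximal (describing∈ D′ l) lt
        ... | yes b∈ | _       = ⊑-trans (D′.positive b∈) above
        ... | no b∉′ | inj₁ c∈ = ⊥-elim (none (lose c∈ (a∈ , b∉′)))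
        ... | no _   | inj₂ p  = ⊑-trans (∧-glb (⊑-trans below (⊑-trans ax-∧E₁ p)) ⊑-refl)
                                  (refute v (Describing.describes D′))
        result : Γ′ ⊑ G′
        result with all-or L (λ x∈ → present′ (sublists-⊆ label∈ x∈) (⊑-trans below (⊑-trans ax-∧E₁ (positive x∈))))
                  | present′ (closed ab∈ ⇒ˡ) (⊑-trans below ax-∧E₂)
        ... | inj₂ p   | _       = p
        ... | inj₁ _   | inj₂ p  = p
        ... | inj₁ sup | inj₁ a∈ with ⊆⇒⊇⊎⊏ {L} {label v} (λ {_} → All.lookup sup)
        -- The label of `v` cannot coincide with `L`, since it contains `a`.
        ...   | inj₁ sub′ = ⊥-elim (a∉ (sub′ (closed ab∈ ⇒ˡ) a∈))
        ...   | inj₂ lt with describing-legit k D′ (<-≤-trans (proj₂ lt) (≤-pred rank<k))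
        ...     | inj₂ p = p
        ...     | inj₁ l = conclude lt a∈ l

    local : ∀ a → a ∈ Ψ → Local L cs a ⊎ Γ ⊑ G
    local ⊥' a∈ = →ᶻ (⊥' ∈? L) λ m → inj₂ (⊑-trans (positive m) ax-⊥E)
    local (var p) a∈ = inj₁ tt
    local (a ∧ b) ab∈ =
      →ᶻ (a ∧ b ∈? L) (λ m → present (closed ab∈ ∧ˡ) (⊑-trans (positive m) ax-∧E₁)
                          ×ᶻ present (closed ab∈ ∧ʳ) (⊑-trans (positive m) ax-∧E₂))
      ×ᶻ →ᶻ (a ∈? L) λ m → →ᶻ (b ∈? L) λ n → present ab∈ (∧-glb (positive m) (positive n))
    local (a ∨ b) ab∈ =
      →ᶻ (a ∨ b ∈? L) split
      ×ᶻ →ᶻ (a ∈? L) (λ m → present ab∈ (⊑-trans (positive m) ax-∨I₁))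
      ×ᶻ →ᶻ (b ∈? L) (λ m → present ab∈ (⊑-trans (positive m) ax-∨I₂))
      where
      split : a ∨ b ∈ L → (a ∈ L ⊎ b ∈ L) ⊎ Γ ⊑ G
      split m with negative (closed ab∈ ∨ˡ) | negative (closed ab∈ ∨ʳ)
      ... | inj₁ n | _      = inj₁ (inj₁ n)
      ... | inj₂ _ | inj₁ n = inj₁ (inj₂ n)
      ... | inj₂ p | inj₂ q = inj₂ (⊑-trans (positive m) (∨-lub p q))
    local (a ⇒ b) ab∈ =
      →ᶻ ((a ⇒ b) ∈? L) (λ m → →ᶻ (a ∈? L) λ n → present (closed ab∈ ⇒ʳ) (positive m $⊑ positive n))
      ×ᶻ witness
      where
      witness : (a ⇒ b ∈ L ⊎ (a ∈ L × b ∉ L) ⊎ Any (λ c → a ∈ label c × b ∉ label c) cs) ⊎ Γ ⊑ G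
      witness with negative ab∈ | a ∈? L | b ∈? L | witness? a b cs
      ... | inj₁ m | _     | _     | _     = inj₁ (inj₁ m)
      ... | inj₂ p | _     | yes n | _     = inj₂ (⊑-trans (⊑-trans (positive n) ax-K) p)
      ... | inj₂ p | yes m | no n  | _     = inj₁ (inj₂ (inj₁ (m , n)))
      ... | inj₂ p | no _  | no _  | yes w = inj₁ (inj₂ (inj₂ w))
      ... | inj₂ p | no m  | no n  | no w  = inj₂ (⊑-trans (unwitnessed ab∈ m n w) p)
    local (○ a) a∈ = inj₁ tt
    local (◇ a) a∈ = inj₁ tt

  describe : ∀ {Γ G} (d : Decided Γ G) → (∃[ v ] v ∈ all-trees × Describing Γ G v) ⊎ Γ ⊑ G
  describe d with description d
  ... | v , D with describing-legit (suc (rank (label v))) D (n<1+n _)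
  ...   | inj₁ l = inj₁ (v , describing∈ D l , D)
  ...   | inj₂ p = inj₂ p

  -- The temporal successor relation and derivations from successors.

  Sensible : List Form → List Form → Form → Set
  Sensible L L′ (○ a) = (○ a ∈ L → a ∈ L′) × (a ∈ L′ → ○ a ∈ L)
  -- The fixed-point equation for `◇ a` across one step. It allows postponing `a` forever;
  -- `Fulfilled` deals with that.
  Sensible L L′ (◇ a) = (◇ a ∈ L → a ∈ L ⊎ ◇ a ∈ L′) × (a ∈ L → ◇ a ∈ L) × (◇ a ∈ L′ → ◇ a ∈ L)
  Sensible L L′ _     = ⊤

  sensible? : ∀ L L′ a → Dec (Sensible L L′ a)
  sensible? L L′ ⊥'      = yes tt
  sensible? L L′ (var p) = yes tt
  sensible? L L′ (a ∧ b) = yes tt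
  sensible? L L′ (a ∨ b) = yes tt
  sensible? L L′ (a ⇒ b) = yes tt
  sensible? L L′ (○ a)   = ((○ a ∈? L) →-dec (a ∈? L′)) ×-dec ((a ∈? L′) →-dec (○ a ∈? L))
  sensible? L L′ (◇ a)   = ((◇ a ∈? L) →-dec ((a ∈? L) ⊎-dec (◇ a ∈? L′)))
    ×-dec ((a ∈? L) →-dec (◇ a ∈? L)) ×-dec ((◇ a ∈? L′) →-dec (◇ a ∈? L))

  sensible-resp : ∀ {L L₁ L₂} → L₁ ⊆ L₂ → L₂ ⊆ L₁ → ∀ a → Sensible L L₁ a → Sensible L L₂ a
  sensible-resp f g ⊥'      _ = tt
  sensible-resp f g (var p) _ = tt
  sensible-resp f g (a ∧ b) _ = tt
  sensible-resp f g (a ∨ b) _ = tt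
  sensible-resp f g (a ⇒ b) _ = tt
  sensible-resp f g (○ a) (p , q) = (λ m → f (p m)) , λ m → q (g m)
  sensible-resp f g (◇ a) (p , q , r) =
    (λ m → [ inj₁ , (λ n → inj₂ (f n)) ]′ (p m)) , q , λ m → r (g m)

  infix 4 _↦_

  -- The condition on kids is forward confluence, which later lifts paths into neighbourhoods.
  data _↦_ : Tree → Tree → Set where
    step : ∀ {L cs v} → All (Sensible L (label v)) Ψ → All (λ c → Any (c ↦_) (desc v)) cs → node L cs ↦ v

  _↦?_ : ∀ w v → Dec (w ↦ v)
  kids↦? : ∀ cs v → Dec (All (λ c → Any (c ↦_) (desc v)) cs)
  node L cs ↦? v with All.all? (sensible? L (label v)) Ψ | kids↦? cs v
  ... | yes s | yes k = yes (step s k)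
  ... | no ¬s | _     = no λ { (step s k) → ¬s s }
  ... | yes _ | no ¬k = no λ { (step s k) → ¬k k }
  kids↦? []       v = yes []
  kids↦? (c ∷ cs) v with any? (c ↦?_) (desc v) | kids↦? cs v
  ... | yes p | yes ps = yes (p ∷ ps)
  ... | no ¬p | _      = no λ { (p ∷ _) → ¬p p }
  ... | yes _ | no ¬ps = no λ { (_ ∷ ps) → ¬ps ps }

  ↦-sensible : ∀ {w v a} → w ↦ v → a ∈ Ψ → Sensible (label w) (label v) a
  ↦-sensible (step s _) a∈ = All.lookup s a∈

  ↦-confluent : ∀ {w v u} → w ↦ v → u ≽ w → ∃[ v′ ] v′ ≽ v × u ↦ v′
  kids-confluent : ∀ {cs v u} → All (λ c → Any (c ↦_) (desc v)) cs → u ∈ descs cs → ∃[ v′ ] v′ ≽ v × u ↦ v′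
  ↦-confluent {node L cs} w↦v (here refl)        = _ , ≽-refl , w↦v
  ↦-confluent {node L cs} (step _ k) (there u∈)  = kids-confluent k u∈
  kids-confluent {c ∷ cs} (p ∷ ps) u∈ with ∈-++⁻ (desc c) u∈
  ... | inj₂ u∈cs = kids-confluent ps u∈cs
  ... | inj₁ u≽c with find p
  ...   | d , d≽v , c↦d with ↦-confluent c↦d u≽c
  ...     | v′ , v′≽d , u↦v′ = v′ , ≽-trans v′≽d d≽v , u↦v′

  desc-resp : ∀ {x} u v → kids u ⊆ kids v → x ∈ desc u → x ≡ u ⊎ x ∈ desc v
  desc-resp (node L cs) (node L′ ds) sup (here e)  = inj₁ e
  desc-resp (node L cs) (node L′ ds) sup (there m) with descs⁻ cs m
  ... | c , c∈ , x≽c = inj₂ (there (descs⁺ (sup c∈) x≽c))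

  module _ {u v : Tree} (sub : label u ⊆ label v) (sup : label v ⊆ label u) (kids-sub : kids u ⊆ kids v) where

    -- A kid of `w` may step to `u` itself, which need not lie in `desc v`; recursion on `w` then
    -- redirects it to `v`.
    ↦-resp : ∀ w → w ↦ u → w ↦ v
    kids↦-resp : ∀ {cs} → All (λ c → Any (c ↦_) (desc u)) cs → All (λ c → Any (c ↦_) (desc v)) cs
    ↦-resp (node L cs) (step s k) = step (All.map (λ {a} → sensible-resp sub sup a) s) (kids↦-resp k)
    kids↦-resp [] = []
    kids↦-resp {c ∷ _} (p ∷ ps) with find p
    ... | x , x∈ , c↦x with desc-resp u v kids-sub x∈
    ...   | inj₁ refl = lose ≽-refl (↦-resp c c↦x) ∷ kids↦-resp ps
    ...   | inj₂ x∈v  = lose x∈v c↦x ∷ kids↦-resp ps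

  -- Compare labels. A formula of `label v` absent from `u` gives `Γ ⊑ Sim u`; if `label u` is
  -- strictly larger, `maximal` applies. If they agree, `maximal` applies to each kid of `u`, and
  -- when all of them are kids of `v`, `↦-resp` replaces `u` by `v`.
  covers : ∀ {Γ G u v} → Describing Γ G v → u ∈ all-trees →
           (∀ {w} → w ↦ u → Any (w ↦_) (desc v)) ⊎ Γ ⊑ Sim u
  covers {Γ} {G} {u} {v} D u∈ with all-or {P = _∈ label u} {Z = Γ ⊑ Sim u} (label v) included
    where
    included : ∀ {x} → x ∈ label v → x ∈ label u ⊎ Γ ⊑ Sim u
    included {x} x∈ with x ∈? label u
    ... | yes m = inj₁ m
    ... | no ¬m = inj₂ (⊑-trans (Describes.positive (Describing.describes D) x∈)
                                (missing-⊑Sim u (sublists-⊆ (Describing.label∈ D) x∈) ¬m))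
  ... | inj₂ p = inj₂ p
  ... | inj₁ all with ⊆⇒⊇⊎⊏ {label v} {label u} (λ {_} → All.lookup all)
  ...   | inj₂ lt with Describing.maximal D u∈ lt
  ...     | inj₁ c∈ = inj₁ λ w↦u → lose (kid-≽ c∈) w↦u
  ...     | inj₂ p  = inj₂ p
  covers {Γ} {G} {u} {v} D u∈ | inj₁ all | inj₁ sup with all-or {P = _∈ kids v} {Z = Γ ⊑ Sim u} (kids u) kid-included
    where
    kid-included : ∀ {c} → c ∈ kids u → c ∈ kids v ⊎ Γ ⊑ Sim u
    kid-included {c} c∈ with WellFormed.kid-⊏ (well-formed u∈) c∈
    ... | u⊆c , lt with Describing.maximal D (WellFormed.kid∈ (well-formed u∈) c∈)
                          ((λ m → u⊆c (All.lookup all m)) , <-≤-trans lt (rank-anti (λ {_} → All.lookup all)))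
    ...   | inj₁ m = inj₁ m
    ...   | inj₂ p = inj₂ (⊑-trans p (kid-⊑Sim u c∈))
  ... | inj₂ p = inj₂ p
  ... | inj₁ kids-all = inj₁ λ {w} w↦u →
    lose ≽-refl (↦-resp (λ {_} m → sup (WellFormed.label⊆ (well-formed u∈) m) m)
                        (λ {_} → All.lookup all) (λ {_} → All.lookup kids-all) w w↦u)

  -- Decide the next moment and describe it by `v`. If `w ↦ v`, the hypothesis refutes the pair
  -- under `○`. A failure of `Sensible` contradicts a temporal axiom. If a kid `c` has no successor
  -- in `desc v`, then `covers` gives `○ (Sim u)` for every successor `u` of `c`, and recursion
  -- yields `Sim c`, which lies below the goal.
  successors⊑○Sim : ∀ w {Γ} → (∀ {v} → v ∈ all-trees → w ↦ v → Γ ⊑ ○ (Sim v)) → Γ ⊑ Sim w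
  kids-covered : ∀ cs {Γ v} → (∀ {w u} → u ∈ all-trees → w ↦ u → Any (w ↦_) (desc v) ⊎ Γ ⊑ ○ (Sim u)) →
                 All (λ c → Any (c ↦_) (desc v)) cs ⊎ ∃[ c ] c ∈ cs × Γ ⊑ Sim c
  kids-covered [] f = inj₁ []
  kids-covered (c ∷ cs) {Γ} {v} f with any? (c ↦?_) (desc v)
  ... | no ¬p = inj₂ (c , here refl , successors⊑○Sim c λ u∈ c↦u →
                  [ (λ p → ⊥-elim (¬p p)) , (λ p → p) ]′ (f u∈ c↦u))
  ... | yes p with kids-covered cs {Γ} {v} f
  ...   | inj₁ ps = inj₁ (p ∷ ps)
  ...   | inj₂ (d , d∈ , q) = inj₂ (d , there d∈ , q)
  successors⊑○Sim (node L cs) {Γ} hyp = ⊑Sim-intro (node L cs) λ below positive negative kids⊑ →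
    -- Under `○` the accumulation starts from the trivial pair: necessitation supplies `○ ⊤'`, and
    -- N1 bounds `○ ⊥'`.
    decide ○ ax-N2 ax-N3 decisive {Γ₀ = ⊤'} {⊥'} (weaken (nec ⊑-refl)) (⊑-trans ax-N1 ax-⊥E)
      λ {Γ″} {G″} {Γ₁} {G₁} lower upper _ _ now later d →
        conclude (⊑-trans lower below) (λ a∈ → ⊑-trans lower (positive a∈))
                 (λ {a} a∈ a∉ → ⊑-trans (negative a∈ a∉) upper) (λ c∈ → ⊑-trans (kids⊑ c∈) upper) now later (describe d)
    where
    conclude : ∀ {Γ′ G Γ₁ G₁} → Γ′ ⊑ Γ → (∀ {a} → a ∈ L → Γ′ ⊑ a) → (∀ {a} → a ∈ Ψ → a ∉ L → a ⊑ G) →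
               (∀ {c} → c ∈ cs → Sim c ⊑ G) → Γ′ ⊑ ○ Γ₁ → ○ G₁ ⊑ G →
               (∃[ v ] v ∈ all-trees × Describing Γ₁ G₁ v) ⊎ Γ₁ ⊑ G₁ → Γ′ ⊑ G
    conclude _ _ _ _ now later (inj₂ p) = ⊑-trans now (⊑-trans (○-mono p) later)
    conclude {Γ′} {G} {Γ₁} {G₁} below positive negative kids⊑ now later (inj₁ (v , v∈ , D))
      with all-or {P = Sensible L (label v)} {Z = Γ′ ⊑ G} Ψ (λ {a} → sensible a)
         | kids-covered cs {Γ′} {v} covered
      where
      open Describes (Describing.describes D) renaming (positive to positive′; negative′ to negative″) using ()
      □⁺ : ∀ {a} → a ∈ label v → Γ′ ⊑ ○ a
      □⁺ m = ⊑-trans now (○-mono (positive′ m))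
      □⁻ : ∀ {a} → a ∈ Ψ → a ∉ label v → ○ a ⊑ G
      □⁻ a∈ a∉ = ⊑-trans (○-mono (negative″ a∈ a∉)) later
      present : ∀ {a} → a ∈ Ψ → Γ′ ⊑ a → a ∈ L ⊎ Γ′ ⊑ G
      present {a} a∈ p with a ∈? L
      ... | yes m = inj₁ m
      ... | no ¬m = inj₂ (⊑-trans p (negative a∈ ¬m))
      next : ∀ {a} → a ∈ Ψ → Γ′ ⊑ ○ a → a ∈ label v ⊎ Γ′ ⊑ G
      next {a} a∈ p with a ∈? label v
      ... | yes m = inj₁ m
      ... | no ¬m = inj₂ (⊑-trans p (□⁻ a∈ ¬m))
      eventually : ∀ {a} → ◇ a ∈ Ψ → ◇ a ∈ L → (a ∈ L ⊎ ◇ a ∈ label v) ⊎ Γ′ ⊑ G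
      eventually {a} ◇∈ m with a ∈? L | ◇ a ∈? label v
      ... | yes n | _     = inj₁ (inj₁ n)
      ... | no _  | yes n = inj₁ (inj₂ n)
      ... | no p  | no q  = inj₂ (⊑-trans (⊑-trans (positive m) ◇-unfold)
                                   (∨-lub (negative (closed ◇∈ ◇◁) p) (□⁻ ◇∈ q)))
      sensible : ∀ a → a ∈ Ψ → Sensible L (label v) a ⊎ Γ′ ⊑ G
      sensible ⊥'      _ = inj₁ tt
      sensible (var p) _ = inj₁ tt
      sensible (a ∧ b) _ = inj₁ tt
      sensible (a ∨ b) _ = inj₁ tt
      sensible (a ⇒ b) _ = inj₁ tt
      sensible (○ a) ○∈ =
        →ᶻ (○ a ∈? L) (λ m → next (closed ○∈ ○◁) (positive m))
        ×ᶻ →ᶻ (a ∈? label v) (λ m → present ○∈ (□⁺ m))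
      sensible (◇ a) ◇∈ =
        →ᶻ (◇ a ∈? L) (eventually ◇∈)
        ×ᶻ →ᶻ (a ∈? L) (λ m → present ◇∈ (⊑-trans (positive m) (⊑-trans ax-∨I₁ ax-E1)))
        ×ᶻ →ᶻ (◇ a ∈? label v) (λ m → present ◇∈ (⊑-trans (□⁺ m) (⊑-trans ax-∨I₂ ax-E1)))
      covered : ∀ {w u} → u ∈ all-trees → w ↦ u → Any (w ↦_) (desc v) ⊎ Γ′ ⊑ ○ (Sim u)
      covered u∈ w↦u with covers D u∈
      ... | inj₁ f = inj₁ (f w↦u)
      ... | inj₂ p = inj₂ (⊑-trans now (○-mono p))
    ... | inj₂ p | _ = p
    ... | inj₁ _ | inj₂ (c , c∈ , p) = ⊑-trans p (kids⊑ c∈)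
    ... | inj₁ s | inj₁ k = ⊑-trans (⊑-trans (∧-glb (⊑-trans below (hyp v∈ (step s k))) now) ax-N2)
                              (⊑-trans (○-mono (refute v (Describing.describes D))) later)

  -- With `φ` as the goal, a describing tree containing `φ` closes the derivation, and any other is
  -- refuted by its `Sim`.
  completeness : ∀ φ → φ ∈ Ψ → (∀ {v} → v ∈ all-trees → φ ∈ label v ⊎ ⊢ Sim v) → ⊢ φ
  completeness φ φ∈ hyp = mp ⊑-refl (decide-id {⊤'} λ _ upper d → conclude upper (describe d))
    where
    conclude : ∀ {Γ G} → φ ⊑ G → (∃[ v ] v ∈ all-trees × Describing Γ G v) ⊎ Γ ⊑ G → Γ ⊑ G
    conclude upper (inj₂ p) = p
    conclude upper (inj₁ (v , v∈ , D)) with hyp v∈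
    ... | inj₁ m = ⊑-trans (Describes.positive (Describing.describes D) m) upper
    ... | inj₂ p = ⊑-trans (∧-glb (weaken p) ⊑-refl) (refute v (Describing.describes D))

  -- Contraction: `Sim v` is an implication whose premise, through `a`, already implies `Sim v`.
  absurd-label : ∀ {a} v → a ∈ label v → a ⊑ Sim v → ⊢ Sim v
  absurd-label v a∈ p = mp (⊑-refl {⊥'}) (⊑Sim-intro v λ {Γ} {G} _ positive negative kids⊑ →
    let negative′ : ∀ {b} → b ∈ Ψ → b ∈ label v ⊎ b ⊑ G
        negative′ {b} b∈ = [ inj₁ , (λ b∉ → inj₂ (negative b∈ b∉)) ]′ (toSum (b ∈? label v))
        D : Describes Γ G v
        D = record { positive = positive ; negative = negative′ ; kids⊑ = kids⊑ }
    in ⊑-trans (∧-glb (⊑-trans (positive a∈) p) ⊑-refl) (refute v D))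

  -- Elimination of defective trees.

  data Reach (M : List Tree) (a : Form) (v : Tree) : Set where
    now   : a ∈ label v → Reach M a v
    later : ∀ {u} → v ↦ u → u ∈ M → Reach M a u → Reach M a v

  Fulfilled : List Tree → Tree → Form → Set
  Fulfilled M v (◇ a) = ◇ a ∈ label v → Reach M a v
  Fulfilled M v _     = ⊤

  Accounted : List Tree → Set
  Accounted M = ∀ {v} → v ∈ all-trees → v ∈ M ⊎ ⊢ Sim v

  record Viable (M : List Tree) (v : Tree) : Set where
    field
      kids⊆     : All (_∈ M) (kids v)
      serial    : ∃[ u ] u ∈ M × v ↦ u
      fulfilled : All (Fulfilled M v) Ψ

  module _ {M : List Tree} (M⊆ : M ⊆ all-trees) (accounted : Accounted M) where

    -- R holds the trees not yet known to reach a; once it is stable, ⋀ (map Sim R) is a pre-fixed point of ○ above a.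
    reach⊎⊢Sim : ∀ {a} → ◇ a ∈ Ψ → ∀ n R → length R ≤ n → R ⊆ M → (∀ {v} → v ∈ M → Reach M a v ⊎ v ∈ R) →
            ∀ {v} → v ∈ M → ◇ a ∈ label v → Reach M a v ⊎ ⊢ Sim v
    reach⊎⊢Sim {a} ◇∈ n R le R⊆ cover {v} v∈ ◇∈v with all-or-remove {P = Stuck} {Q = Reach M a} R stuck⊎reach
      where
      Stuck : Tree → Set
      Stuck u = a ∉ label u × All (λ w → u ↦ w → w ∈ R) M
      stuck⊎reach : ∀ {u} → u ∈ R → Stuck u ⊎ Reach M a u
      stuck⊎reach {u} u∈ with a ∈? label u
      ... | yes m = inj₂ (now m)
      ... | no ¬m = inj₁ ¬m ×ᶻ all-or M λ {w} w∈ → →ᶻ (u ↦? w) λ u↦w →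
              [ (λ r → inj₂ (later u↦w w∈ r)) , inj₁ ]′ (cover w∈)
    reach⊎⊢Sim {a} ◇∈ (suc n) R le R⊆ cover v∈ ◇∈v | inj₂ (x , ys , x∈ , r , ys⊆ , len , split) =
      reach⊎⊢Sim ◇∈ n ys (≤-pred (subst (_≤ suc n) len le)) (λ m → R⊆ (ys⊆ m)) cover′ v∈ ◇∈v
      where
      cover′ : ∀ {u} → u ∈ M → Reach M a u ⊎ u ∈ ys
      cover′ u∈ with cover u∈
      ... | inj₁ s = inj₁ s
      ... | inj₂ m with split m
      ...   | inj₁ refl = inj₁ r
      ...   | inj₂ m′   = inj₂ m′
    reach⊎⊢Sim {a} ◇∈ zero R le R⊆ cover v∈ ◇∈v | inj₂ (x , ys , x∈ , r , ys⊆ , len , split)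
      with () ← subst (_≤ zero) len le
    reach⊎⊢Sim {a} ◇∈ n R le R⊆ cover {v} v∈ ◇∈v | inj₁ stuck with cover v∈
    ... | inj₁ r   = inj₁ r
    -- The chain is `◇ a ⊑ ◇ χ ⊑ χ ⊑ Sim v`, while `◇ a` lies in the label of `v`.
    ... | inj₂ v∈R = inj₂ (absurd-label v ◇∈v (⊑-trans (◇-mono a⊑χ) (⊑-trans (◇-ind ○χ⊑χ) (⋀-lb (∈-map⁺ Sim v∈R)))))
      where
      χ : Form
      χ = ⋀ (map Sim R)
      χ-glb : ∀ {b} → (∀ {u} → u ∈ R → b ⊑ Sim u) → b ⊑ χ
      χ-glb {b} f = ⋀-glb (map Sim R) λ m → let u , u∈ , e = ∈-map⁻ Sim m in subst (b ⊑_) (sym e) (f u∈)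
      a⊑χ : a ⊑ χ
      a⊑χ = χ-glb λ {u} u∈ → missing-⊑Sim u (closed ◇∈ ◇◁) (proj₁ (stuck u∈))
      ○χ⊑χ : ○ χ ⊑ χ
      ○χ⊑χ = χ-glb λ {u} u∈ → successors⊑○Sim u λ w∈ u↦w →
        -- A successor still in `M` lies in `R` by stability; a discarded one has a derivable `Sim`,
        -- so necessitation applies.
        [ (λ w∈M → ○-mono (⋀-lb (∈-map⁺ Sim (All.lookup (proj₂ (stuck u∈)) w∈M u↦w))))
        , (λ p → weaken (nec p)) ]′ (accounted w∈)

    -- Each defect has its derivation: a discarded kid through `kid-⊑Sim`, a lack of successors
    -- through `successors⊑○Sim`, an unmet `◇` through `reach⊎⊢Sim`.
    viable⊎⊢Sim : ∀ {v} → v ∈ M → Viable M v ⊎ ⊢ Sim v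
    viable⊎⊢Sim {v} v∈ with all-or {P = _∈ M} {Z = ⊢ Sim v} (kids v) kid | has-successor | all-or {P = Fulfilled M v} {Z = ⊢ Sim v} Ψ (λ {a} → fulfil a)
      where
      kid : ∀ {c} → c ∈ kids v → c ∈ M ⊎ ⊢ Sim v
      kid c∈ with accounted (WellFormed.kid∈ (well-formed (M⊆ v∈)) c∈)
      ... | inj₁ m = inj₁ m
      ... | inj₂ p = inj₂ (mp p (kid-⊑Sim v c∈))
      has-successor : (∃[ u ] u ∈ M × v ↦ u) ⊎ ⊢ Sim v
      has-successor with all-or {P = λ u → v ↦ u → ⊢ Sim u} {Z = ∃[ u ] u ∈ M × v ↦ u} all-trees
                           (λ {u} u∈ → →ᶻ (v ↦? u) λ v↦u → [ (λ m → inj₂ (u , m , v↦u)) , inj₁ ]′ (accounted u∈))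
      ... | inj₂ s = inj₁ s
      ... | inj₁ none = inj₂ (mp (⊑-refl {⊥'}) (successors⊑○Sim v λ u∈ v↦u → weaken (nec (All.lookup none u∈ v↦u))))
      fulfil : ∀ a → a ∈ Ψ → Fulfilled M v a ⊎ ⊢ Sim v
      fulfil ⊥'      _ = inj₁ tt
      fulfil (var p) _ = inj₁ tt
      fulfil (a ∧ b) _ = inj₁ tt
      fulfil (a ∨ b) _ = inj₁ tt
      fulfil (a ⇒ b) _ = inj₁ tt
      fulfil (○ a)   _ = inj₁ tt
      fulfil (◇ a) ◇∈ = →ᶻ (◇ a ∈? label v) (reach⊎⊢Sim ◇∈ (length M) M ≤-refl (λ m → m) inj₂ v∈)
    ... | inj₂ p | _ | _ = inj₂ p
    ... | inj₁ _ | inj₂ p | _ = inj₂ p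
    ... | inj₁ _ | inj₁ _ | inj₂ p = inj₂ p
    ... | inj₁ k | inj₁ s | inj₁ f = inj₁ record { kids⊆ = k ; serial = s ; fulfilled = f }

  Quasimodel : List Tree → Set
  Quasimodel M = M ⊆ all-trees × (∀ {v} → v ∈ M → Viable M v)

  -- Removing one tree can spoil the viability of others, so the whole check restarts on the shorter
  -- list. The result may be empty.
  eliminate : ∀ n M → length M ≤ n → M ⊆ all-trees → Accounted M → ∃[ M′ ] Quasimodel M′ × Accounted M′
  eliminate n M le M⊆ accounted with all-or-remove {P = Viable M} {Q = λ v → ⊢ Sim v} M (viable⊎⊢Sim M⊆ accounted)
  ... | inj₁ viable = M , (M⊆ , viable) , accounted
  eliminate zero M le M⊆ accounted | inj₂ (x , ys , _ , p , ys⊆ , len , split) with () ← subst (_≤ zero) len le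
  eliminate (suc n) M le M⊆ accounted | inj₂ (x , ys , _ , p , ys⊆ , len , split) =
    eliminate n ys (≤-pred (subst (_≤ suc n) len le)) (λ m → M⊆ (ys⊆ m)) accounted′
    where
    accounted′ : Accounted ys
    accounted′ v∈ with accounted v∈
    ... | inj₂ q = inj₂ q
    ... | inj₁ m with split m
    ...   | inj₁ refl = inj₂ p
    ...   | inj₂ m′   = inj₁ m′

  quasimodel : ∃[ M ] Quasimodel M × Accounted M
  quasimodel = eliminate (length all-trees) all-trees ≤-refl (λ m → m) inj₁

  -- Unwinding a quasimodel into fair infinite runs.

  module Unwinding (M : List Tree) (Q : Quasimodel M) where

    well-formedᴹ : ∀ {v} → v ∈ M → WellFormed v
    well-formedᴹ v∈ = well-formed (proj₁ Q v∈)

    viable : ∀ {v} → v ∈ M → Viable M v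
    viable = proj₂ Q

    ≽-in-M : ∀ {u v} → v ∈ M → u ≽ v → u ∈ M × label v ⊆ label u
    ≽-in-M = ≽-hereditary {Q = _∈ M} (λ v∈ c∈ → All.lookup (Viable.kids⊆ (viable v∈)) c∈
                                              , proj₁ (WellFormed.kid-⊏ (well-formedᴹ v∈) c∈)) _

    -- Both constructors contain a step, so `next` can always advance.
    data Segment : Tree → Set where
      end  : ∀ {v w} → v ↦ w → w ∈ M → Segment v
      cons : ∀ {v w} → v ↦ w → w ∈ M → Segment w → Segment v

    data Hits (a : Form) : ∀ {v} → Segment v → Set where
      start : ∀ {v} {s : Segment v} → a ∈ label v → Hits a s
      final : ∀ {v w} {e : v ↦ w} {m : w ∈ M} → a ∈ label w → Hits a (end e m)
      tail  : ∀ {v w} {e : v ↦ w} {m : w ∈ M} {s : Segment w} → Hits a s → Hits a (cons e m s)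

    persist : ∀ {v w a} → v ↦ w → ◇ a ∈ Ψ → ◇ a ∈ label v → a ∈ label v ⊎ ◇ a ∈ label w
    persist e ◇∈ = proj₁ (↦-sensible e ◇∈)

    Targets : List Form → Set
    Targets as = ∀ {a} → a ∈ as → ◇ a ∈ Ψ

    Serves : List Form → ∀ {v} → Segment v → Set
    Serves as {v} s = ∀ {a} → a ∈ as → ◇ a ∈ label v → Hits a s

    -- Obligations are met one after another: walk to `a`, then serve the rest from there. During
    -- the walk `persist` carries along each `◇` whose body has not yet been met.
    serve : ∀ as → Targets as → ∀ {v} → v ∈ M → Σ[ s ∈ Segment v ] Serves as s
    approach : ∀ a as → Targets (a ∷ as) → ∀ {v} → v ∈ M → Reach M a v → Σ[ s ∈ Segment v ] Serves (a ∷ as) s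
    serve [] _ v∈ with Viable.serial (viable v∈)
    ... | w , w∈ , e = end e w∈ , λ ()
    serve (a ∷ as) t {v} v∈ with ◇ a ∈? label v
    ... | yes m = approach a as t v∈ (All.lookup (Viable.fulfilled (viable v∈)) (t (here refl)) m)
    ... | no ¬m with serve as (λ b∈ → t (there b∈)) v∈
    ...   | s , f = s , λ { (here refl) n → ⊥-elim (¬m n) ; (there b∈) n → f b∈ n }
    approach a as t v∈ (now m) with serve as (λ b∈ → t (there b∈)) v∈
    ... | s , f = s , λ { (here refl) _ → start m ; (there b∈) n → f b∈ n }
    approach a as t v∈ (later e u∈ r) with approach a as t u∈ r
    ... | s , f = cons e u∈ s , λ b∈ n → [ start , (λ n′ → tail (f b∈ n′)) ]′ (persist e (t b∈) n)

    ◇-bodies : List Form → List Form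
    ◇-bodies [] = []
    ◇-bodies (◇ a ∷ as) = a ∷ ◇-bodies as
    ◇-bodies (_ ∷ as)   = ◇-bodies as

    ◇-bodies⁺ : ∀ {a} as → ◇ a ∈ as → a ∈ ◇-bodies as
    ◇-bodies⁺ (◇ _ ∷ as)   (here refl) = here refl
    ◇-bodies⁺ (⊥' ∷ as)    (there m) = ◇-bodies⁺ as m
    ◇-bodies⁺ (var _ ∷ as) (there m) = ◇-bodies⁺ as m
    ◇-bodies⁺ (_ ∧ _ ∷ as) (there m) = ◇-bodies⁺ as m
    ◇-bodies⁺ (_ ∨ _ ∷ as) (there m) = ◇-bodies⁺ as m
    ◇-bodies⁺ ((_ ⇒ _) ∷ as) (there m) = ◇-bodies⁺ as m
    ◇-bodies⁺ (○ _ ∷ as)   (there m) = ◇-bodies⁺ as m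
    ◇-bodies⁺ (◇ _ ∷ as)   (there m) = there (◇-bodies⁺ as m)

    ◇-bodies⁻ : ∀ {a} as → a ∈ ◇-bodies as → ◇ a ∈ as
    ◇-bodies⁻ (⊥' ∷ as)    m = there (◇-bodies⁻ as m)
    ◇-bodies⁻ (var _ ∷ as) m = there (◇-bodies⁻ as m)
    ◇-bodies⁻ (_ ∧ _ ∷ as) m = there (◇-bodies⁻ as m)
    ◇-bodies⁻ (_ ∨ _ ∷ as) m = there (◇-bodies⁻ as m)
    ◇-bodies⁻ ((_ ⇒ _) ∷ as) m = there (◇-bodies⁻ as m)
    ◇-bodies⁻ (○ _ ∷ as)   m = there (◇-bodies⁻ as m)
    ◇-bodies⁻ (◇ _ ∷ as)   (here refl) = here refl
    ◇-bodies⁻ (◇ _ ∷ as)   (there m) = there (◇-bodies⁻ as m)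

    fair : ∀ {v} → v ∈ M → Σ[ s ∈ Segment v ] (∀ {a} → ◇ a ∈ Ψ → ◇ a ∈ label v → Hits a s)
    fair v∈ with serve (◇-bodies Ψ) (◇-bodies⁻ Ψ) v∈
    ... | s , f = s , λ ◇∈ → f (◇-bodies⁺ Ψ ◇∈)

    -- The rest of the planned segment is part of the state, which makes the run deterministic.
    record State : Set where
      constructor state
      field
        {current} : Tree
        current∈  : current ∈ M
        segment   : Segment current

    open State

    next : State → State
    next (state _ (end _ w∈))    = state w∈ (proj₁ (fair w∈))
    next (state _ (cons _ w∈ s)) = state w∈ s

    next-↦ : ∀ σ → current σ ↦ current (next σ)
    next-↦ (state _ (end e _))    = e
    next-↦ (state _ (cons e _ _)) = e

    run : State → ℕ → State
    run σ zero    = σ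
    run σ (suc n) = run (next σ) n

    run-suc : ∀ σ n → run σ (suc n) ≡ next (run σ n)
    run-suc σ zero    = refl
    run-suc σ (suc n) = run-suc (next σ) n

    run-+ : ∀ σ k n → run (run σ n) k ≡ run σ (k + n)
    run-+ σ k zero    = cong (run σ) (sym (+-identityʳ k))
    run-+ σ k (suc n) = trans (run-+ (next σ) k n) (cong (run σ) (sym (+-suc k n)))

    Realised : Form → State → Set
    Realised a σ = ∃[ k ] a ∈ label (current (run σ k))

    realised-later : ∀ {a σ} → Realised a (next σ) → Realised a σ
    realised-later (k , m) = suc k , m

    hits⇒realised : ∀ {a v} {v∈ : v ∈ M} {s : Segment v} → Hits a s → Realised a (state v∈ s)
    hits⇒realised (start m) = 0 , m
    hits⇒realised (final m) = 1 , m
    hits⇒realised (tail {m = w∈} h) = realised-later (hits⇒realised {v∈ = w∈} h)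

    -- The current segment need not be fair: an obligation it leaves open persists to its endpoint,
    -- where a fair segment begins.
    ◇-realised : ∀ {a v} (v∈ : v ∈ M) (s : Segment v) → ◇ a ∈ Ψ → ◇ a ∈ label v → Realised a (state v∈ s)
    ◇-realised v∈ (end e w∈) ◇∈ m with persist e ◇∈ m
    ... | inj₁ n = 0 , n
    ... | inj₂ n = realised-later (hits⇒realised {v∈ = w∈} (proj₂ (fair w∈) ◇∈ n))
    ◇-realised v∈ (cons e w∈ s) ◇∈ m with persist e ◇∈ m
    ... | inj₁ n = 0 , n
    ... | inj₂ n = realised-later (◇-realised w∈ s ◇∈ n)

    -- The dynamical system of fair paths.

    record Path : Set where
      field
        at       : ℕ → Tree
        at∈      : ∀ n → at n ∈ M
        at-↦     : ∀ n → at n ↦ at (suc n)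
        realises : ∀ n {a} → ◇ a ∈ Ψ → ◇ a ∈ label (at n) → ∃[ k ] a ∈ label (at (k + n))

    open Path

    unwind : State → Path
    unwind σ = record
      { at       = λ n → current (run σ n)
      ; at∈      = λ n → current∈ (run σ n)
      ; at-↦     = λ n → subst (λ τ → current (run σ n) ↦ current τ) (sym (run-suc σ n)) (next-↦ (run σ n))
      ; realises = λ n {a} ◇∈ m →
          let k , h = ◇-realised (current∈ (run σ n)) (segment (run σ n)) ◇∈ m
          in k , subst (λ τ → a ∈ label (current τ)) (run-+ σ k n) h }

    shift : Path → Path
    shift x = record
      { at       = λ n → at x (suc n)
      ; at∈      = λ n → at∈ x (suc n)
      ; at-↦     = λ n → at-↦ x (suc n)
      ; realises = λ n {a} ◇∈ m →
          let k , h = realises x (suc n) ◇∈ m in k , subst (λ i → a ∈ label (at x i)) (+-suc k n) h }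

    at-iter : ∀ x k n → at (iter shift k x) n ≡ at x (k + n)
    at-iter x zero    n = refl
    at-iter x (suc k) n = trans (at-iter x k (suc n)) (cong (at x) (+-suc k n))

    Above : ℕ → Path → Path → Set
    Above n y x = ∀ i → i ≤ n → at y i ≽ at x i

    -- Confluence copies the first `n` steps of `x` above it, starting from `v`; beyond them
    -- `unwind` restores fairness. This provides points of a basic neighbourhood of `x` with a
    -- prescribed start.
    lift-segment : ∀ n x {v} → v ∈ M → v ≽ at x 0 →
                   Σ[ s ∈ Segment v ] (∀ (v∈ : v ∈ M) → Above n (unwind (state v∈ s)) x)
    lift-segment zero x v∈ v≽ with Viable.serial (viable v∈)
    -- Only moment 0 must lie above `x`, so any successor completes the segment.
    ... | w , w∈ , e = end e w∈ , λ { _ zero z≤n → v≽ }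
    lift-segment (suc n) x v∈ v≽ with ↦-confluent (at-↦ x 0) v≽
    ... | w , w≽ , e with ≽-in-M (at∈ x 1) w≽
    ...   | w∈ , _ with lift-segment n (shift x) w∈ w≽
    ...     | s , above = cons e w∈ s , λ { _ zero _ → v≽ ; _ (suc i) (s≤s le) → above w∈ i le }

    -- The subspace topology of the product of the up-set topologies on the trees, with the sets
    -- `Above n y x` as basic neighbourhoods of `x`.
    pathTopology : Topology Path
    pathTopology = record
      { Open     = λ U → ∀ x → U x → ∃[ n ] (∀ y → Above n y x → U y)
      ; Open-ext = λ U⊆V V⊆U o x Vx → let n , h = o x (V⊆U x Vx) in n , λ y a → U⊆V y (h y a)
      ; Open-⊤   = λ x _ → 0 , λ _ _ → tt
      ; Open-∩   = λ oU oV x (Ux , Vx) →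
          let m , f = oU x Ux ; n , g = oV x Vx
          in m ⊔ n , λ y a → f y (λ i le → a i (≤-trans le (m≤m⊔n m n))) , g y (λ i le → a i (≤-trans le (m≤n⊔m m n)))
      ; Open-⋃   = λ I U o x (i , Ux) → let n , f = o i x Ux in n , λ y a → i , f y a }

    pathSystem : DynSys
    pathSystem = record
      { Carrier    = Path
      ; topology   = pathTopology
      ; f          = shift
      -- One more moment is needed because `shift` drops the first.
      ; continuous = λ o x Ux → let n , g = o (shift x) Ux in suc n , λ y a → g (shift y) (λ i le → a (suc i) (s≤s le)) }

    -- The truth lemma.

    valuation : Valuation pathSystem
    valuation = (λ p x → var p ∈ label (at x 0))
              , λ p x m → 0 , λ y a → proj₂ (≽-in-M (at∈ x 0) (a 0 z≤n)) m

    infix 4 _⊩_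

    _⊩_ : Path → Form → Set₁
    x ⊩ a = ⟦_⟧ pathSystem a valuation x

    local-at : ∀ x {a} → a ∈ Ψ → Local (label (at x 0)) (kids (at x 0)) a
    local-at x = All.lookup (WellFormed.legit (well-formedᴹ (at∈ x 0)))

    ◇-backwards : ∀ x {a} → ◇ a ∈ Ψ → ∀ n → a ∈ label (at x n) → ◇ a ∈ label (at x 0)
    ◇-backwards x ◇∈ zero    m = proj₁ (proj₂ (↦-sensible (at-↦ x 0) ◇∈)) m
    ◇-backwards x ◇∈ (suc n) m = proj₂ (proj₂ (↦-sensible (at-↦ x 0) ◇∈)) (◇-backwards (shift x) ◇∈ n m)

    -- The two directions are mutual because implication exchanges them; fairness enters only in
    -- `sound` for `◇`.
    sound    : ∀ a → a ∈ Ψ → ∀ x → a ∈ label (at x 0) → x ⊩ a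
    complete : ∀ a → a ∈ Ψ → ∀ x → x ⊩ a → a ∈ label (at x 0)
    sound ⊥'      a∈ x m = ⊥-elim (local-at x a∈ m)
    sound (var p) a∈ x m = lift m
    sound (a ∧ b) a∈ x m with proj₁ (local-at x a∈) m
    ... | ma , mb = sound a (closed a∈ ∧ˡ) x ma , sound b (closed a∈ ∧ʳ) x mb
    sound (a ∨ b) a∈ x m with proj₁ (local-at x a∈) m
    ... | inj₁ ma = inj₁ (sound a (closed a∈ ∨ˡ) x ma)
    ... | inj₂ mb = inj₂ (sound b (closed a∈ ∨ʳ) x mb)
    sound (a ⇒ b) a∈ x m =
        -- This neighbourhood constrains moment 0 only, where labels grow upwards and so keep the
        -- implication.
        (λ y → at y 0 ≽ at x 0)
      , (λ y y≽ → 0 , λ z z≽ → ≽-trans (z≽ 0 z≤n) y≽)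
      , (λ y y≽ ya → sound b (closed a∈ ⇒ʳ) y
          (proj₁ (local-at y a∈) (proj₂ (≽-in-M (at∈ x 0) y≽) m) (complete a (closed a∈ ⇒ˡ) y ya)))
      , ≽-refl
    sound (○ a) a∈ x m = sound a (closed a∈ ○◁) (shift x) (proj₁ (↦-sensible (at-↦ x 0) a∈) m)
    sound (◇ a) a∈ x m with realises x 0 a∈ m
    ... | k , h = k , sound a (closed a∈ ◇◁) (iter shift k x) (subst (λ v → a ∈ label v) (sym (at-iter x k 0)) h)
    complete ⊥'      a∈ x (lift ())
    complete (var p) a∈ x (lift m) = m
    complete (a ∧ b) a∈ x (xa , xb) =
      proj₂ (local-at x a∈) (complete a (closed a∈ ∧ˡ) x xa) (complete b (closed a∈ ∧ʳ) x xb)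
    complete (a ∨ b) a∈ x (inj₁ xa) = proj₁ (proj₂ (local-at x a∈)) (complete a (closed a∈ ∨ˡ) x xa)
    complete (a ∨ b) a∈ x (inj₂ xb) = proj₂ (proj₂ (local-at x a∈)) (complete b (closed a∈ ∨ʳ) x xb)
    complete (a ⇒ b) a∈ x (U , U-open , U⊆ , Ux) with proj₂ (local-at x a∈)
    ... | inj₁ m = m
    ... | inj₂ (inj₁ (m , ¬m)) =
      ⊥-elim (¬m (complete b (closed a∈ ⇒ʳ) x (U⊆ x Ux (sound a (closed a∈ ⇒ˡ) x m))))
    -- The open set `U` contains all paths above `x` up to moment `n`. Lifting `x` from the
    -- witnessing kid `c` gives such a path, whose first label has `a` but not `b`.
    ... | inj₂ (inj₂ w) with find w | U-open x Ux
    ...   | c , c∈ , m , ¬m | n , U-above with ≽-in-M (at∈ x 0) (kid-≽ c∈)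
    ...     | c∈M , _ with lift-segment n x c∈M (kid-≽ c∈)
    ...       | s , above = ⊥-elim (¬m (complete b (closed a∈ ⇒ʳ) y
                  (U⊆ y (U-above y (above c∈M)) (sound a (closed a∈ ⇒ˡ) y m))))
      where
      y : Path
      y = unwind (state c∈M s)
    complete (○ a) a∈ x xa = proj₂ (↦-sensible (at-↦ x 0) a∈) (complete a (closed a∈ ○◁) (shift x) xa)
    complete (◇ a) a∈ x (n , xa) = ◇-backwards x a∈ n
      (subst (λ i → a ∈ label (at x i)) (+-identityʳ n)
        (subst (λ v → a ∈ label v) (at-iter x n 0) (complete a (closed a∈ ◇◁) (iter shift n x) xa)))

    valid⇒∈label : ∀ {a} → a ∈ Ψ → Valid a → ∀ {v} → v ∈ M → a ∈ label v
    valid⇒∈label {a} a∈ valid v∈ =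
      let x = unwind (state v∈ (proj₁ (fair v∈))) in complete a a∈ x (valid pathSystem valuation x)

theorem8p4 : ∀ (φ : Form) → Valid φ → ⊢ φ
theorem8p4 φ valid with Filtration.quasimodel (sub φ) (sub-closed φ)
... | M , Q , accounted = F.completeness φ (sub-refl φ) λ v∈ →
  [ (λ v∈M → inj₁ (F.Unwinding.valid⇒∈label M Q (sub-refl φ) valid v∈M)) , inj₂ ]′ (accounted v∈)
  where
  module F = Filtration (sub φ) (sub-closed φ)
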